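{- Suppose $|\mathsf{Ag}|\ge2$. Then, both when equivalence of formulas is taken over the class of all models and when it is taken over the class of all similarity models: (1) $\mathcal{EL}\prec\mathcal{ELC}$, $\mathcal{ELD}\prec\mathcal{ELCD}$, $\mathcal{ELM}\prec\mathcal{ELCM}$ and $\mathcal{ELDM}\prec\mathcal{ELCDM}$; (2) $\mathcal{EL}\prec\mathcal{ELD}$, $\mathcal{ELC}\prec\mathcal{ELCD}$, $\mathcal{ELM}\prec\mathcal{ELDM}$ and $\mathcal{ELCM}\prec\mathcal{ELCDM}$; (3) $\mathcal{EL}\prec\mathcal{ELM}$, $\mathcal{ELC}\prec\mathcal{ELCM}$, $\mathcal{ELD}\prec\mathcal{ELDM}$ and $\mathcal{ELCD}\prec\mathcal{ELCDM}$; (4) $\mathcal{ELC}$, $\mathcal{ELD}$ and $\mathcal{ELM}$ are pairwise incomparable; (5) $\mathcal{ELCD}$, $\mathcal{ELCM}$ and $\mathcal{ELDM}$ are pairwise incomparable; (6) $\mathcal{ELC}$ is incomparable with $\mathcal{ELDM}$; (7) $\mathcal{ELD}$ is incomparable with $\mathcal{ELCM}$; (8) $\mathcal{ELM}$ is incomparable with $\mathcal{ELCD}$.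
   Context: Languages. Fix a countably infinite set $\mathsf{Prop}$ of propositional variables and a finite nonempty set $\mathsf{Ag}$ of agents. A group is a nonempty subset $G\subseteq\mathsf{Ag}$. The formulas of $\mathcal{EL}$ are given by $\varphi::=p\mid\neg\varphi\mid(\varphi\to\varphi)\mid K_a\varphi$ with $p\in\mathsf{Prop}$, $a\in\mathsf{Ag}$. For a subset $X$ of $\{C,D,M\}$, the language $\mathcal{ELX}$ adds to this grammar the clause $C_G\varphi$ if $C\in X$, the clause $D_G\varphi$ if $D\in X$, and the clause $M_G\varphi$ if $M\in X$ ($G$ ranging over groups); this gives the eight languages. Other Boolean connectives are abbreviations, and $E_G\varphi:=\bigwedge_{a\in G}K_a\varphi$, $E_G^1\varphi:=E_G\varphi$, $E_G^{n}\varphi:=E_GE_G^{n-1}\varphi$. Models. A model is a tuple $M=(W,A,E,C,\nu)$ with $W$ a nonempty set, $A$ an arbitrary set (possibly empty), $E:W\times W\to\wp(A)$, $C:\mathsf{Ag}\to\wp(A)$, $\nu:W\to\wp(\mathsf{Prop})$. It is a similarity model if for all $s,t\in W$: $E(s,t)=A$ implies $s=t$, and $E(s,t)=E(t,s)$. Semantics. $M,s\models p$ iff $p\in\nu(s)$; $\neg,\to$ as usual; $M,s\models K_a\psi$ iff for all $t\in W$, $C(a)\subseteq E(s,t)$ implies $M,t\models\psi$; $M,s\models C_G\psi$ iff $M,s\models E_G^n\psi$ for all integers $n\ge1$; $M,s\models D_G\psi$ iff for all $t\in W$, $\bigcup_{a\in G}C(a)\subseteq E(s,t)$ implies $M,t\models\psi$;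 $M,s\models M_G\psi$ iff for all $t\in W$, $\bigcap_{a\in G}C(a)\subseteq E(s,t)$ implies $M,t\models\psi$. Expressivity. Two formulas are equivalent over a class of models if they are true at exactly the same states of the same models of the class. $\mathcal L_1\preceq\mathcal L_2$ means that for every $\mathcal L_1$-formula there is an equivalent $\mathcal L_2$-formula; $\mathcal L_1\equiv\mathcal L_2$ means both $\mathcal L_1\preceq\mathcal L_2$ and $\mathcal L_2\preceq\mathcal L_1$; $\mathcal L_1\prec\mathcal L_2$ means $\mathcal L_1\preceq\mathcal L_2$ and not $\mathcal L_1\equiv\mathcal L_2$; $\mathcal L_1,\mathcal L_2$ are incomparable if neither $\mathcal L_1\preceq\mathcal L_2$ nor $\mathcal L_2\preceq\mathcal L_1$. -}

module Defs where

open import Axiom.ExcludedMiddle using (ExcludedMiddle)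
open import Data.Fin using (Fin)
import Data.Fin.Subset as Sub
open import Data.Fin.Subset.Properties using (_∈?_)
open import Data.List using (List; []; _∷_; foldr; map; filter; allFin)
open import Data.List.Membership.Propositional using (_∈_)
open import Data.List.Membership.Propositional.Properties
  using (∈-filter⁺; ∈-filter⁻; ∈-allFin)
open import Data.List.Relation.Unary.All as All using (All; []; _∷_)
open import Data.Nat using (ℕ; zero; suc; _≤_)
open import Data.Product using (_×_; _,_; ∃; proj₁; proj₂)
open import Data.Unit using (⊤)
open import Function using (_⇔_; mk⇔; Equivalence)
open import Level using (0ℓ)
open import Relation.Binary.PropositionalEquality using (_≡_)
open import Relation.Nullary using (¬_)
open import Relation.Nullary.Decidable using (decidable-stable)
open import Relation.Unary using (Pred; _⊆_; _≐_; Universal; ⋃; ⋂)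

-- The agents are Fin n and the propositional variables are ℕ.

Group : ℕ → Set
Group n = ∃ λ (G : Sub.Subset n) → Sub.Nonempty G

Member : ∀ {n} → Group n → Set
Member (G , _) = ∃ λ a → a Sub.∈ G

data Op : Set where
  𝖢 𝖣 𝖬 : Op

-- A language is given by the group modalities it has besides the K_a.
Language : Set
Language = List Op

EL ELC ELD ELM ELCD ELCM ELDM ELCDM : Language
EL    = []
ELC   = 𝖢 ∷ []
ELD   = 𝖣 ∷ []
ELM   = 𝖬 ∷ []
ELCD  = 𝖢 ∷ 𝖣 ∷ []
ELCM  = 𝖢 ∷ 𝖬 ∷ []
ELDM  = 𝖣 ∷ 𝖬 ∷ []
ELCDM = 𝖢 ∷ 𝖣 ∷ 𝖬 ∷ []

infixr 5 _⇒_
infix  6 ~_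

data Form (n : ℕ) (X : Language) : Set where
  var : ℕ → Form n X
  ~_  : Form n X → Form n X
  _⇒_ : Form n X → Form n X → Form n X
  K   : Fin n → Form n X → Form n X
  C   : 𝖢 ∈ X → Group n → Form n X → Form n X
  D   : 𝖣 ∈ X → Group n → Form n X → Form n X
  M   : 𝖬 ∈ X → Group n → Form n X → Form n X

record Model (n : ℕ) : Set₁ where
  field
    W   : Set
    w₀  : W  -- W is nonempty
    A   : Set
    E   : W → W → Pred A 0ℓ
    cap : Fin n → Pred A 0ℓ  -- the component C : Ag → ℘(A)
    ν   : W → Pred ℕ 0ℓ

module _ {n : ℕ} (𝔐 : Model n) where
  open Model 𝔐

  IsSimilarity : Set
  IsSimilarity = ∀ s t → (Universal (E s t) → s ≡ t) × E s t ≐ E t s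

  -- The box over the worlds t with S ⊆ E(s,t).
  □ : Pred A 0ℓ → Pred W 0ℓ → Pred W 0ℓ
  □ S P s = ∀ t → S ⊆ E s t → P t

  -- The truth set of E_G^n φ as a function of the truth set of φ.  It is a
  -- function of truth sets because E_G^n φ is not a subformula of C_G φ; see
  -- ⊨C below for the agreement with the abbreviation E_G^n φ.
  Everyone : Group n → Pred W 0ℓ → Pred W 0ℓ
  Everyone G P s = ∀ ((a , _) : Member G) → □ (cap a) P s

  Everyone^ : ℕ → Group n → Pred W 0ℓ → Pred W 0ℓ
  Everyone^ zero    G P = P
  Everyone^ (suc k) G P = Everyone G (Everyone^ k G P)

  ⟦_⟧ : ∀ {X} → Form n X → Pred W 0ℓ
  ⟦ var p ⟧   s = ν s p
  ⟦ ~ φ ⟧     s = ¬ ⟦ φ ⟧ s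
  ⟦ φ ⇒ ψ ⟧   s = ⟦ φ ⟧ s → ⟦ ψ ⟧ s
  ⟦ K a φ ⟧     = □ (cap a) ⟦ φ ⟧
  ⟦ C _ G φ ⟧ s = ∀ k → 1 ≤ k → Everyone^ k G ⟦ φ ⟧ s
  ⟦ D _ G φ ⟧   = □ (⋃[ m ∶ Member G ] cap (proj₁ m)) ⟦ φ ⟧
  ⟦ M _ G φ ⟧   = □ (⋂[ m ∶ Member G ] cap (proj₁ m)) ⟦ φ ⟧

infix 3 _,_⊨_

_,_⊨_ : ∀ {n X} (𝔐 : Model n) → Model.W 𝔐 → Form n X → Set
𝔐 , s ⊨ φ = ⟦_⟧ 𝔐 φ s

data Class : Set where
  allModels similarityModels : Class

_∈ᶜ_ : ∀ {n} → Model n → Class → Set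
𝔐 ∈ᶜ allModels        = ⊤
𝔐 ∈ᶜ similarityModels = IsSimilarity 𝔐

module Expressivity (n : ℕ) (𝒦 : Class) where

  infix 4 _≈_ _≼_ _≅_ _≺_ _∥_

  _≈_ : ∀ {X Y} → Form n X → Form n Y → Set₁
  φ ≈ ψ = ∀ (𝔐 : Model n) → 𝔐 ∈ᶜ 𝒦 → ∀ s → (𝔐 , s ⊨ φ) ⇔ (𝔐 , s ⊨ ψ)

  _≼_ _≅_ _≺_ _∥_ : Language → Language → Set₁
  X ≼ Y = ∀ (φ : Form n X) → ∃ λ (ψ : Form n Y) → φ ≈ ψ
  X ≅ Y = X ≼ Y × Y ≼ X
  X ≺ Y = X ≼ Y × ¬ (X ≅ Y)
  X ∥ Y = ¬ (X ≼ Y) × ¬ (Y ≼ X)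

-- The abbreviations ∧ and E_G^n.  Since conjunction abbreviates ¬ (φ → ¬ ψ),
-- its truth condition is that of × only classically, so the agreement of the
-- clause for C_G with the formulas E_G^n φ is stated under excluded middle.
module _ {n : ℕ} {X : Language} where

  infixr 6 _∧_

  _∧_ : Form n X → Form n X → Form n X
  φ ∧ ψ = ~ (φ ⇒ ~ ψ)

  ⋀ : List (Form n X) → Form n X
  ⋀ = foldr _∧_ (var 0 ⇒ var 0)

  E[_] : Group n → Form n X → Form n X
  E[ G , _ ] φ = ⋀ (map (λ a → K a φ) (filter (_∈? G) (allFin n)))

  E^[_,_] : ℕ → Group n → Form n X → Form n X
  E^[ zero  , G ] φ = φ
  E^[ suc k , G ] φ = E[ G ] (E^[ k , G ] φ)

  module _ (em : ExcludedMiddle 0ℓ) (𝔐 : Model n) where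

    ⊨⋀K : ∀ as φ s → (𝔐 , s ⊨ ⋀ (map (λ a → K a φ) as)) ⇔ All (λ a → 𝔐 , s ⊨ K a φ) as
    ⊨⋀K []       φ s = mk⇔ (λ _ → []) (λ _ x → x)
    ⊨⋀K (a ∷ as) φ s = mk⇔
      (λ h → decidable-stable em (λ ¬k → h (λ k _ → ¬k k))
           ∷ to (decidable-stable em (λ ¬r → h (λ _ r → ¬r r))))
      (λ { (k ∷ ks) h → h k (from ks) })
      where open Equivalence (⊨⋀K as φ s)

    ⊨E^ : ∀ k G φ s → (𝔐 , s ⊨ E^[ k , G ] φ) ⇔ Everyone^ 𝔐 k G (⟦_⟧ 𝔐 φ) s
    ⊨E^ zero    G         φ s = mk⇔ (λ x → x) (λ x → x)
    ⊨E^ (suc k) G@(S , _) φ s = mk⇔ only-if if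
      where
      open Equivalence (⊨⋀K (filter (_∈? S) (allFin n)) (E^[ k , G ] φ) s)

      only-if : 𝔐 , s ⊨ E^[ suc k , G ] φ → Everyone^ 𝔐 (suc k) G (⟦_⟧ 𝔐 φ) s
      only-if h (a , a∈S) t r = Equivalence.to (⊨E^ k G φ t)
        (All.lookup (to h) (∈-filter⁺ (_∈? S) (∈-allFin a) a∈S) t r)

      if : Everyone^ 𝔐 (suc k) G (⟦_⟧ 𝔐 φ) s → 𝔐 , s ⊨ E^[ suc k , G ] φ
      if h = from (All.tabulate λ {a} a∈ t r → Equivalence.from (⊨E^ k G φ t)
        (h (a , proj₂ (∈-filter⁻ (_∈? S) {xs = allFin n} a∈)) t r))

    ⊨C : ∀ 𝖢∈X G φ s →
         (𝔐 , s ⊨ C 𝖢∈X G φ) ⇔ (∀ k → 1 ≤ k → 𝔐 , s ⊨ E^[ k , G ] φ)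
    ⊨C _ G φ s = mk⇔
      (λ h k 1≤k → Equivalence.from (⊨E^ k G φ s) (h k 1≤k))
      (λ h k 1≤k → Equivalence.to (⊨E^ k G φ s) (h k 1≤k))

{-# OPTIONS --safe #-}

-- X ≼ Y holds when X ⊆ Y, and fails as soon as some modality of X is missing
-- from Y.  The missing modality is detected on similarity models with two kinds
-- of agents: agent 0 and all the others.
-- * C: on the line ℕ, where every other group modality is the box over the
--   neighbours, a C-free formula only sees a bounded neighbourhood, whereas C p
--   at s detects a failure of p at 0 however large s is.
-- * D: if ν is constant and every K_a is serial then so is every M_G, and no
--   D-free formula tells two worlds apart; but the intersection of the serial
--   relations of two agents may be empty at some worlds and not at others.
-- * M: if ν is constant and no K_a has a successor then no D_G has one, and no
--   M-free formula tells two worlds apart; but the intersection of two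
--   capability sets may be contained in an edge that contains neither of them.
module Submission where

open import Data.Bool using (Bool; true; false; T)
open import Data.Empty using (⊥; ⊥-elim)
open import Data.Fin using (zero; suc)
import Data.Fin.Subset as Sub
open import Data.Fin.Subset.Properties using (∈⊤)
open import Data.List.Membership.Propositional using (_∈_; _∉_)
import Data.List.Membership.DecPropositional as DecMembership
import Data.List.Relation.Binary.Subset.DecPropositional as DecSubset
open import Data.List.Relation.Binary.Subset.Propositional using (_⊆_)
open import Data.Nat using (ℕ; zero; suc; _≤_; _<_; _⊔_; z≤n; s≤s)
open import Data.Nat.Properties using (≤-refl; ≤-pred; <⇒≤; m⊔n≤o⇒m≤o; m⊔n≤o⇒n≤o; m≤n⇒m≤1+n)
open import Data.Product using (_×_; _,_; ∃; proj₁; proj₂; swap)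
open import Data.Sum as Sum using (_⊎_; inj₁; inj₂)
open import Data.Unit using (⊤; tt)
open import Function using (_⇔_; mk⇔; Equivalence; id; _∘_)
open import Function.Related.TypeIsomorphisms using (¬-cong-⇔; →-cong-⇔)
open import Level using (0ℓ)
open import Relation.Binary using (DecidableEquality)
open import Relation.Binary.PropositionalEquality using (_≡_; _≢_; refl)
open import Relation.Nullary using (¬_; yes; no; contradiction)
open import Relation.Nullary.Decidable using (True; False; toWitness; toWitnessFalse)
open import Relation.Unary using (Pred; Universal; ⋃; ⋂) renaming (_⊆_ to _⊆′_)
open import Defs

open Equivalence using (to; from)

everyone : ∀ {n} → Group (suc n)
everyone = Sub.⊤ , zero , ∈⊤

-- Congruence and monotonicity of the modal operators.

module _ {n : ℕ} (𝔐 : Model n) where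
  open Model 𝔐

  -- Agreement is demanded only at successors of `s`: on the line it is known only far from 0.
  □-cong : ∀ {S P Q} s → (∀ t → S ⊆′ E s t → P t ⇔ Q t) → □ 𝔐 S P s ⇔ □ 𝔐 S Q s
  □-cong {S} {P} {Q} s P⇔Q = mk⇔ only-if if
    where
    only-if : □ 𝔐 S P s → □ 𝔐 S Q s
    only-if h t r = to (P⇔Q t r) (h t r)

    if : □ 𝔐 S Q s → □ 𝔐 S P s
    if h t r = from (P⇔Q t r) (h t r)

  Everyone^-mono : ∀ {P Q} k G → P ⊆′ Q → Everyone^ 𝔐 k G P ⊆′ Everyone^ 𝔐 k G Q
  Everyone^-mono zero    G P⊆Q   = P⊆Q
  Everyone^-mono (suc k) G P⊆Q h = λ m t r → Everyone^-mono k G P⊆Q (h m t r)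

  Everyone^-universal : ∀ {P} k G → Universal P → Universal (Everyone^ 𝔐 k G P)
  Everyone^-universal zero    G p         = p
  Everyone^-universal (suc k) G p _ _ t _ = Everyone^-universal k G p t

-- Inclusion of languages.

module _ {n : ℕ} where

  embed : ∀ {X Y} → X ⊆ Y → Form n X → Form n Y
  embed X⊆Y (var p)   = var p
  embed X⊆Y (~ φ)     = ~ embed X⊆Y φ
  embed X⊆Y (φ ⇒ ψ)   = embed X⊆Y φ ⇒ embed X⊆Y ψ
  embed X⊆Y (K a φ)   = K a (embed X⊆Y φ)
  embed X⊆Y (C i G φ) = C (X⊆Y i) G (embed X⊆Y φ)
  embed X⊆Y (D i G φ) = D (X⊆Y i) G (embed X⊆Y φ)
  embed X⊆Y (M i G φ) = M (X⊆Y i) G (embed X⊆Y φ)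

  ⊨-embed : ∀ {X Y} (X⊆Y : X ⊆ Y) φ (𝔐 : Model n) s → (𝔐 , s ⊨ φ) ⇔ (𝔐 , s ⊨ embed X⊆Y φ)
  ⊨-embed X⊆Y (var p)   𝔐 s = mk⇔ id id
  ⊨-embed X⊆Y (~ φ)     𝔐 s = ¬-cong-⇔ (⊨-embed X⊆Y φ 𝔐 s)
  ⊨-embed X⊆Y (φ ⇒ ψ)   𝔐 s = →-cong-⇔ (⊨-embed X⊆Y φ 𝔐 s) (⊨-embed X⊆Y ψ 𝔐 s)
  ⊨-embed X⊆Y (K a φ)   𝔐 s = □-cong 𝔐 s λ t _ → ⊨-embed X⊆Y φ 𝔐 t
  ⊨-embed X⊆Y (C i G φ) 𝔐 s = mk⇔
    (λ h k 1≤k → Everyone^-mono 𝔐 k G (λ {t} → to   (⊨-embed X⊆Y φ 𝔐 t)) (h k 1≤k))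
    (λ h k 1≤k → Everyone^-mono 𝔐 k G (λ {t} → from (⊨-embed X⊆Y φ 𝔐 t)) (h k 1≤k))
  ⊨-embed X⊆Y (D i G φ) 𝔐 s = □-cong 𝔐 s λ t _ → ⊨-embed X⊆Y φ 𝔐 t
  ⊨-embed X⊆Y (M i G φ) 𝔐 s = □-cong 𝔐 s λ t _ → ⊨-embed X⊆Y φ 𝔐 t

similarity⇒∈ᶜ : ∀ {n} {𝔐 : Model n} 𝒦 → IsSimilarity 𝔐 → 𝔐 ∈ᶜ 𝒦
similarity⇒∈ᶜ allModels        _   = tt
similarity⇒∈ᶜ similarityModels sim = sim

-- Inexpressibility of `C`.

module _ {n : ℕ} where

  Adjacent : ℕ → ℕ → Set
  Adjacent s t = suc s ≡ t ⊎ suc t ≡ s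

  -- The capability false lies in no E s t, so E s t is never all of A.
  line : Pred ℕ 0ℓ → Model (suc n)
  line P = record
    { W   = ℕ
    ; w₀  = 0
    ; A   = Bool
    ; E   = λ s t b → T b × Adjacent s t
    ; cap = λ _ → T
    ; ν   = λ s _ → P s
    }

  line-similarity : ∀ P → IsSimilarity (line P)
  line-similarity P s t = (λ u → ⊥-elim (proj₁ (u false))) , symmetric , symmetric
    where
    symmetric : ∀ {s t b} → T b × Adjacent s t → T b × Adjacent t s
    symmetric (b , e) = b , Sum.swap e

  -- Since `true` is in `S`, every successor is adjacent; a step lowers the position by at most one,
  -- so the bound grows by one.
  □-line-agree : ∀ P Q {S d} {φ ψ : Pred ℕ 0ℓ} → S true →
                 (∀ t → d < t → φ t ⇔ ψ t) →
                 ∀ s → suc d < s → □ (line P) S φ s ⇔ □ (line Q) S ψ s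
  □-line-agree P _ S∋true φ⇔ψ s d<s =
    □-cong (line P) s λ t S⊆E → φ⇔ψ t (step d<s (proj₂ (S⊆E S∋true)))
    where
    step : ∀ {d s t} → suc d < s → Adjacent s t → d < t
    step d<s (inj₁ refl) = m≤n⇒m≤1+n (<⇒≤ d<s)
    step d<s (inj₂ refl) = ≤-pred d<s

  -- The bound `d` is the modal depth of `φ`: the valuations differ only at 0, out of reach from
  -- beyond `d`.
  C-free-line-agree : ∀ {X} → 𝖢 ∉ X → (φ : Form (suc n) X) → ∃ λ d →
    ∀ s → d < s → (line (λ _ → ⊤) , s ⊨ φ) ⇔ (line (0 <_) , s ⊨ φ)
  C-free-line-agree 𝖢∉X (var p) = 0 , λ s 0<s → mk⇔ (λ _ → 0<s) (λ _ → tt)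
  C-free-line-agree 𝖢∉X (~ φ) with d , h ← C-free-line-agree 𝖢∉X φ =
    d , λ s d<s → ¬-cong-⇔ (h s d<s)
  C-free-line-agree 𝖢∉X (φ ⇒ ψ)
    with d , h ← C-free-line-agree 𝖢∉X φ | e , k ← C-free-line-agree 𝖢∉X ψ =
    d ⊔ e , λ s d⊔e<s → →-cong-⇔
      (h s (m⊔n≤o⇒m≤o (suc d) (suc e) d⊔e<s))
      (k s (m⊔n≤o⇒n≤o (suc d) (suc e) d⊔e<s))
  C-free-line-agree 𝖢∉X (K a φ) with d , h ← C-free-line-agree 𝖢∉X φ =
    suc d , □-line-agree (λ _ → ⊤) (0 <_) tt h
  C-free-line-agree 𝖢∉X (C 𝖢∈X G φ) = contradiction 𝖢∈X 𝖢∉X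
  C-free-line-agree 𝖢∉X (D _ (_ , m) φ) with d , h ← C-free-line-agree 𝖢∉X φ =
    suc d , □-line-agree (λ _ → ⊤) (0 <_) (m , tt) h
  C-free-line-agree 𝖢∉X (M _ G φ) with d , h ← C-free-line-agree 𝖢∉X φ =
    suc d , □-line-agree (λ _ → ⊤) (0 <_) (λ _ → tt) h

  -- Descending `s` times from `s` ends at 0, where `0 <_` fails.
  ¬Everyone^-line : ∀ s → ¬ Everyone^ (line (0 <_)) s everyone (0 <_) s
  ¬Everyone^-line zero    ()
  ¬Everyone^-line (suc s) h = ¬Everyone^-line s (h (zero , ∈⊤) s λ b → b , inj₂ refl)

  C-inexpressible : ∀ 𝒦 {X Y} → 𝖢 ∈ X → 𝖢 ∉ Y → ¬ Expressivity._≼_ (suc n) 𝒦 X Y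
  C-inexpressible 𝒦 𝖢∈X 𝖢∉Y X≼Y = ¬Everyone^-line (suc d)
    (from (C≈ψ (line (0 <_)) (inClass _) (suc d))
      (to (agree (suc d) ≤-refl)
        (to (C≈ψ (line (λ _ → ⊤)) (inClass _) (suc d))
          λ k _ → Everyone^-universal (line (λ _ → ⊤)) k everyone _ (suc d)))
      -- The first world beyond the bound is `suc d`, which is also the number of steps from it to
      -- 0.
      (suc d) (s≤s z≤n))
    where
    ψ     = proj₁ (X≼Y (C 𝖢∈X everyone (var 0)))
    C≈ψ   = proj₂ (X≼Y (C 𝖢∈X everyone (var 0)))
    d     = proj₁ (C-free-line-agree 𝖢∉Y ψ)
    agree = proj₂ (C-free-line-agree 𝖢∉Y ψ)

    inClass : ∀ P → line P ∈ᶜ 𝒦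
    inClass P = similarity⇒∈ᶜ 𝒦 (line-similarity P)

-- Truth that does not depend on the world.

module _ {n : ℕ} (𝔐 : Model n) where
  open Model 𝔐

  -- This covers serial and empty relations alike, with no case distinction.
  Homogeneous : Pred A 0ℓ → Set
  Homogeneous S = ∀ {s t} → S ⊆′ E s t → ∀ u → ∃ λ v → S ⊆′ E u v

  Invariant : Pred W 0ℓ → Set
  Invariant P = ∀ s t → P s → P t

  -- A successor of `u` yields one of `s`, where `P` holds; invariance carries `P` over.
  □-invariant : ∀ {S P} → Homogeneous S → Invariant P → Invariant (□ 𝔐 S P)
  □-invariant hom inv s u h t r with v , r′ ← hom r s = inv v t (h v r′)

  module _ (cap-homogeneous : ∀ a → Homogeneous (cap a)) where

    Everyone^-invariant : ∀ {P} k G → Invariant P → Invariant (Everyone^ 𝔐 k G P)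
    Everyone^-invariant zero    G inv = inv
    Everyone^-invariant (suc k) G inv s u h m@(a , _) =
      □-invariant (cap-homogeneous a) (Everyone^-invariant k G inv) s u (h m)

    module _
      {X : Language}
      (ν-invariant : ∀ p → Invariant (λ s → ν s p))
      (⋃-homogeneous : 𝖣 ∈ X → ∀ G → Homogeneous (⋃[ m ∶ Member G ] cap (proj₁ m)))
      (⋂-homogeneous : 𝖬 ∈ X → ∀ G → Homogeneous (⋂[ m ∶ Member G ] cap (proj₁ m)))
      where

      ⟦⟧-invariant : (φ : Form n X) → Invariant (⟦_⟧ 𝔐 φ)
      ⟦⟧-invariant (var p)   = ν-invariant p
      ⟦⟧-invariant (~ φ)     = λ s t h → h ∘ ⟦⟧-invariant φ t s
      ⟦⟧-invariant (φ ⇒ ψ)   = λ s t h → ⟦⟧-invariant ψ s t ∘ h ∘ ⟦⟧-invariant φ t s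
      ⟦⟧-invariant (K a φ)   = □-invariant (cap-homogeneous a) (⟦⟧-invariant φ)
      ⟦⟧-invariant (C _ G φ) = λ s t h k 1≤k →
        Everyone^-invariant k G (⟦⟧-invariant φ) s t (h k 1≤k)
      ⟦⟧-invariant (D i G φ) = □-invariant (⋃-homogeneous i G) (⟦⟧-invariant φ)
      ⟦⟧-invariant (M i G φ) = □-invariant (⋂-homogeneous i G) (⟦⟧-invariant φ)

-- Inexpressibility of `D`.

data Capability : Set where
  α β γ : Capability

data World : Set where
  hub left right : World

-- Each world has an α-link and a β-link, but only at `hub` do they share a target. No link carries
-- γ, so no edge is full.
data Link : World → World → Pred Capability 0ℓ where
  hub-α   : Link hub hub α
  hub-β   : Link hub hub β
  left-α  : Link left left α
  right-α : Link right right α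
  across  : Link left right β
  back    : Link right left β

Link-sym : ∀ {s t c} → Link s t c → Link t s c
Link-sym hub-α   = hub-α
Link-sym hub-β   = hub-β
Link-sym left-α  = left-α
Link-sym right-α = right-α
Link-sym across  = back
Link-sym back    = across

module _ {n : ℕ} where

  serial : Model (suc (suc n))
  serial = record
    { W   = World
    ; w₀  = hub
    ; A   = Capability
    ; E   = Link
    ; cap = λ { zero → _≡ α ; (suc _) → _≡ β }
    ; ν   = λ _ _ → ⊥
    }

  serial-similarity : IsSimilarity serial
  serial-similarity s t = (λ u → contradiction (u γ) λ ()) , Link-sym , Link-sym

  serial-cap : ∀ a u → ∃ λ v → Model.cap serial a ⊆′ Link u v
  serial-cap zero    hub   = hub   , λ { refl → hub-α }
  serial-cap zero    left  = left  , λ { refl → left-α }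
  serial-cap zero    right = right , λ { refl → right-α }
  serial-cap (suc _) hub   = hub   , λ { refl → hub-β }
  serial-cap (suc _) left  = right , λ { refl → across }
  serial-cap (suc _) right = left  , λ { refl → back }

  -- As `var 0` is false everywhere, `D-var` says that no link carries both α and β: true at `left`,
  -- false at `hub`.
  D-inexpressible : ∀ 𝒦 {X Y} → 𝖣 ∈ X → 𝖣 ∉ Y → ¬ Expressivity._≼_ (suc (suc n)) 𝒦 X Y
  D-inexpressible 𝒦 𝖣∈X 𝖣∉Y X≼Y =
    from (D≈ψ hub) (invariant left hub (to (D≈ψ left) D-left)) hub
      λ { ((zero , _) , refl) → hub-α ; ((suc _ , _) , refl) → hub-β }
    where
    D-var = D 𝖣∈X everyone (var 0)
    ψ     = proj₁ (X≼Y D-var)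
    D≈ψ   = proj₂ (X≼Y D-var) serial (similarity⇒∈ᶜ 𝒦 serial-similarity)

    ¬α∧β : ∀ {t} → Link left t α → ¬ Link left t β
    ¬α∧β left-α ()

    D-left : serial , left ⊨ D-var
    D-left t h = ¬α∧β (h ((zero , ∈⊤) , refl)) (h ((suc zero , ∈⊤) , refl))

    invariant = ⟦⟧-invariant serial (λ a _ → serial-cap a) (λ _ _ _ ())
      (λ 𝖣∈Y → contradiction 𝖣∈Y 𝖣∉Y)
      -- The intersection lies inside `cap a` for a member `a`, so it inherits seriality.
      (λ { _ (_ , m@(a , _)) _ u → let v , cap⊆ = serial-cap a u in v , λ c∈⋂ → cap⊆ (c∈⋂ m) })
      ψ

-- Inexpressibility of `M`.

module _ {n : ℕ} where

  -- The two capability sets are {α, γ} and {β, γ}. The loop at `true` is {γ}, exactly their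
  -- intersection; all other edges are empty.
  blind : Model (suc (suc n))
  blind = record
    { W   = Bool
    ; w₀  = true
    ; A   = Capability
    ; E   = λ s t c → c ≡ γ × T s × T t
    ; cap = λ { zero → _≢ β ; (suc _) → _≢ α }
    ; ν   = λ _ _ → ⊥
    }

  blind-similarity : IsSimilarity blind
  blind-similarity s t = (λ u → contradiction (proj₁ (u α)) λ ()) , symmetric , symmetric
    where
    symmetric : ∀ {s t c} → c ≡ γ × T s × T t → c ≡ γ × T t × T s
    symmetric (c≡γ , e) = c≡γ , swap e

  blind-cap : ∀ a {s t} → ¬ (Model.cap blind a ⊆′ Model.E blind s t)
  blind-cap zero    h = contradiction (proj₁ (h {α} λ ())) λ ()
  blind-cap (suc _) h = contradiction (proj₁ (h {β} λ ())) λ ()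

  M-inexpressible : ∀ 𝒦 {X Y} → 𝖬 ∈ X → 𝖬 ∉ Y → ¬ Expressivity._≼_ (suc (suc n)) 𝒦 X Y
  M-inexpressible 𝒦 𝖬∈X 𝖬∉Y X≼Y =
    from (M≈ψ true) (invariant false true (to (M≈ψ false) M-false)) true
      λ { {α} c∈⋂ → contradiction refl (c∈⋂ (suc zero , ∈⊤))
        ; {β} c∈⋂ → contradiction refl (c∈⋂ (zero , ∈⊤))
        ; {γ} _   → refl , tt , tt }
    where
    M-var = M 𝖬∈X everyone (var 0)
    ψ     = proj₁ (X≼Y M-var)
    M≈ψ   = proj₂ (X≼Y M-var) blind (similarity⇒∈ᶜ 𝒦 blind-similarity)

    M-false : blind , false ⊨ M-var
    -- An edge from `false` containing γ would give `T false`, the empty type.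
    M-false t h = proj₁ (proj₂ (h {γ} λ { (zero , _) () ; (suc _ , _) () }))

    invariant = ⟦⟧-invariant blind (λ a h → ⊥-elim (blind-cap a h)) (λ _ _ _ ())
      -- The union contains some `cap a`, so no edge contains it and homogeneity is vacuous.
      (λ { _ (_ , m@(a , _)) h → ⊥-elim (blind-cap a λ c∈cap → h (m , c∈cap)) })
      (λ 𝖬∈Y → contradiction 𝖬∈Y 𝖬∉Y)
      ψ

-- Comparison of the eight languages.

_≟_ : DecidableEquality Op
𝖢 ≟ 𝖢 = yes refl
𝖢 ≟ 𝖣 = no λ ()
𝖢 ≟ 𝖬 = no λ ()
𝖣 ≟ 𝖢 = no λ ()
𝖣 ≟ 𝖣 = yes refl
𝖣 ≟ 𝖬 = no λ ()
𝖬 ≟ 𝖢 = no λ ()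
𝖬 ≟ 𝖣 = no λ ()
𝖬 ≟ 𝖬 = yes refl

open DecMembership _≟_ using (_∈?_)
open DecSubset _≟_ using (_⊆?_)

∈-∉⇒⋠ : ∀ {n} → 2 ≤ n → ∀ 𝒦 o {X Y} → o ∈ X → o ∉ Y → ¬ Expressivity._≼_ n 𝒦 X Y
∈-∉⇒⋠ (s≤s (s≤s _)) 𝒦 𝖢 = C-inexpressible 𝒦
∈-∉⇒⋠ (s≤s (s≤s _)) 𝒦 𝖣 = D-inexpressible 𝒦
∈-∉⇒⋠ (s≤s (s≤s _)) 𝒦 𝖬 = M-inexpressible 𝒦

module Witnesses {n : ℕ} (2≤n : 2 ≤ n) (𝒦 : Class) where
  open Expressivity n 𝒦

  -- For concrete languages the implicit `True` and `False` arguments are solved by evaluation.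
  ≺-by : ∀ o {X Y} {X⊆Y : True (X ⊆? Y)} {o∈Y : True (o ∈? Y)} {o∉X : False (o ∈? X)} →
         X ≺ Y
  ≺-by o {X⊆Y = X⊆Y} {o∈Y} {o∉X} =
    (λ φ → embed (toWitness X⊆Y) φ , λ 𝔐 _ → ⊨-embed (toWitness X⊆Y) φ 𝔐) ,
    (∈-∉⇒⋠ 2≤n 𝒦 o (toWitness o∈Y) (toWitnessFalse o∉X) ∘ proj₂)

  ∥-by : ∀ o o′ {X Y}
         {o∈X : True (o ∈? X)} {o∉Y : False (o ∈? Y)}
         {o′∈Y : True (o′ ∈? Y)} {o′∉X : False (o′ ∈? X)} → X ∥ Y
  ∥-by o o′ {o∈X = o∈X} {o∉Y} {o′∈Y} {o′∉X} =
    ∈-∉⇒⋠ 2≤n 𝒦 o (toWitness o∈X) (toWitnessFalse o∉Y) ,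
    ∈-∉⇒⋠ 2≤n 𝒦 o′ (toWitness o′∈Y) (toWitnessFalse o′∉X)

corollary13 : (n : ℕ) → 2 ≤ n → (𝒦 : Class) →
    let open Expressivity n 𝒦 in
    (EL ≺ ELC × ELD ≺ ELCD × ELM ≺ ELCM × ELDM ≺ ELCDM)
    × (EL ≺ ELD × ELC ≺ ELCD × ELM ≺ ELDM × ELCM ≺ ELCDM)
    × (EL ≺ ELM × ELC ≺ ELCM × ELD ≺ ELDM × ELCD ≺ ELCDM)
    × (ELC ∥ ELD × ELC ∥ ELM × ELD ∥ ELM)
    × (ELCD ∥ ELCM × ELCD ∥ ELDM × ELCM ∥ ELDM)
    × (ELC ∥ ELDM)
    × (ELD ∥ ELCM)
    × (ELM ∥ ELCD)
corollary13 n 2≤n 𝒦 =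
    (≺-by 𝖢 , ≺-by 𝖢 , ≺-by 𝖢 , ≺-by 𝖢)
  , (≺-by 𝖣 , ≺-by 𝖣 , ≺-by 𝖣 , ≺-by 𝖣)
  , (≺-by 𝖬 , ≺-by 𝖬 , ≺-by 𝖬 , ≺-by 𝖬)
  , (∥-by 𝖢 𝖣 , ∥-by 𝖢 𝖬 , ∥-by 𝖣 𝖬)
  , (∥-by 𝖣 𝖬 , ∥-by 𝖢 𝖬 , ∥-by 𝖢 𝖣)
  , ∥-by 𝖢 𝖣
  , ∥-by 𝖣 𝖢
  , ∥-by 𝖬 𝖢
  where open Witnesses 2≤n 𝒦
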